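{- Let $n\geq 2$ be an integer and let $L$ be a quasigroup of order $n$ with underlying set $I_n=\{1,2,\ldots,n\}$, whose product of $x$ and $y$ is written $xy$. Let $\Gamma_1$ be the digraph with vertex set $I_n\times I_n\times\mathbb{Z}_2$ whose darts (arcs) are exactly the following: \begin{itemize} \item $(x,y,i)\mapsto(z,y,i)$ for all $i\in\mathbb{Z}_2$, $x,y,z\in I_n$, $x\neq z$; \item $(x,y,i)\mapsto(x,z,i)$ for all $i\in\mathbb{Z}_2$, $x,y,z\in I_n$, $y\neq z$; \item $(x,y,0)\mapsto(xy,z,1)$ for all $x,y,z\in I_n$; \item $(x,y,1)\mapsto(z,yx,0)$ for all $x,y,z\in I_n$. \end{itemize} Then $\Gamma_1$ is a directed strongly regular graph with parameter set $(2n^2,\,3n-2,\,2n-1,\,n-1,\,3)$.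
   Context: A quasigroup is a set $Q$ with a binary operation such that for all $a,b\in Q$ each of the equations $ax=b$ and $ya=b$ has a unique solution in $Q$; equivalently, its multiplication table is a Latin square, $xy$ being the symbol in row $x$ and column $y$. (In particular loops, i.e. quasigroups with an identity element, are allowed.) A directed strongly regular graph (DSRG) with parameter set $(N,k,t,\lambda,\mu)$ (in this order) is a loopless directed graph on $N$ vertices that is regular of valency $k$ (every vertex has in-degree and out-degree $k$), such that every vertex is incident with exactly $t$ undirected edges (an undirected edge is a pair of opposite arcs), and for any two distinct vertices $x,y$ the number of directed paths of length 2 from $x$ to $y$ is $\lambda$ if there is an arc from $x$ to $y$ and $\mu$ otherwise. Equivalently, its adjacency matrix $A$ (with zero diagonal) satisfies $AJ=JA=kJ$ and $A^2=tI+\lambda A+\mu(J-I-A)$, where $J$ is the all-one matrix and $I$ the identity matrix. -}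

module Defs where

open import Algebra.Core using (Op₂)
open import Data.Fin.Base using (Fin)
open import Data.Fin.Patterns using (0F; 1F)
open import Data.List.Base using (List; length)
open import Data.List.Membership.Propositional using (_∈_)
open import Data.List.Relation.Unary.Unique.Propositional using (Unique)
open import Data.Nat.Base using (ℕ)
open import Data.Product.Base using (_×_; _,_; ∃)
open import Function.Bundles using (_⇔_)
open import Relation.Binary.Core using (Rel)
open import Relation.Binary.PropositionalEquality.Core using (_≡_; _≢_)
open import Relation.Nullary.Negation.Core using (¬_)
open import Relation.Unary using (Pred; U)
open import Level using (0ℓ)

-- The elements are listed without repetition, so an element x is counted
-- once, however many proofs of P x there are.
HasCard : {A : Set} → Pred A 0ℓ → ℕ → Set
HasCard {A} P m =
  ∃ λ (xs : List A) → Unique xs × (∀ x → x ∈ xs ⇔ P x) × length xs ≡ m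

-- Only the inhabitation of Arc x y is meaningful: there are no multiple arcs.
record Digraph : Set₁ where
  field
    Vertex : Set
    Arc    : Rel Vertex 0ℓ

-- Directed strongly regular graph with parameter set (N, k, t, l, m); here
-- l and m are the parameters usually written λ and μ.
record IsDSRG (G : Digraph) (N k t l m : ℕ) : Set where
  open Digraph G
  -- A directed path of length 2 from x to y is identified with its middle
  -- vertex, and an undirected edge at x with its other end.
  field
    order      : HasCard {Vertex} U N
    loopless   : ∀ x → ¬ Arc x x
    out-degree : ∀ x → HasCard (λ y → Arc x y) k
    in-degree  : ∀ x → HasCard (λ y → Arc y x) k
    undirected : ∀ x → HasCard (λ y → Arc x y × Arc y x) t
    paths-arc  : ∀ x y → x ≢ y → Arc x y →
                 HasCard (λ z → Arc x z × Arc z y) l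
    paths-¬arc : ∀ x y → x ≢ y → ¬ Arc x y →
                 HasCard (λ z → Arc x z × Arc z y) m

-- I_n is Fin n and ℤ₂ is Fin 2.
module _ {n : ℕ} (_∙_ : Op₂ (Fin n)) where

  data Γ₁-Arc : Rel (Fin n × Fin n × Fin 2) 0ℓ where
    fst-coord : ∀ i x y z → x ≢ z → Γ₁-Arc (x , y , i) (z , y , i)
    snd-coord : ∀ i x y z → y ≢ z → Γ₁-Arc (x , y , i) (x , z , i)
    zero-one  : ∀ x y z → Γ₁-Arc (x , y , 0F) (x ∙ y , z , 1F)
    one-zero  : ∀ x y z → Γ₁-Arc (x , y , 1F) (z , y ∙ x , 0F)

  Γ₁ : Digraph
  Γ₁ = record { Vertex = Fin n × Fin n × Fin 2 ; Arc = Γ₁-Arc }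

{-# OPTIONS --safe #-}
-- The map (x , y , i) ↦ (y , x , 1 - i) is an automorphism of Γ₁, so only
-- vertices of layer 0 need to be considered as starting points (or, for the
-- in-degree, as end points). From there each set to be counted is a disjoint
-- union of boxes whose sides are points, complements of one or two points, or
-- all of Fin n (the in-neighbours in the other layer form the graph of a
-- division map instead): inside a layer Γ₁ is the rook's graph, and a path
-- that leaves a layer is found by solving an equation in the quasigroup.
module Submission where

open import Defs
open import Algebra.Core using (Op₂)
open import Algebra.Structures using (IsQuasigroup)
open import Data.Empty using (⊥)
open import Data.Fin.Base using (Fin; opposite)
open import Data.Fin.Patterns using (0F; 1F)
open import Data.List.Base using (List; []; _∷_; _++_; length; map; allFin; cartesianProduct)
open import Data.List.Membership.Propositional using (_∈_)
open import Data.List.Membership.Propositional.Properties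
  using (∈-map⁺; ∈-map⁻; ∈-++⁺ˡ; ∈-++⁺ʳ; ∈-++⁻; ∈-∃++; ∈-allFin;
         ∈-cartesianProduct⁺; ∈-cartesianProduct⁻)
open import Data.List.Properties using (length-map; length-++; length-tabulate)
open import Data.List.Relation.Binary.Permutation.Propositional using (↭-sym; ↭⇒↭ₛ)
open import Data.List.Relation.Binary.Permutation.Propositional.Properties
  using (∈-resp-↭; ↭-length; shift)
import Data.List.Relation.Binary.Permutation.Setoid.Properties as Permutationₛ
open import Data.List.Relation.Unary.All using ([])
open import Data.List.Relation.Unary.AllPairs using ([]; _∷_)
open import Data.List.Relation.Unary.Any using (here; there)
open import Data.List.Relation.Unary.Unique.Propositional.Properties
  using (map⁺; ++⁺; allFin⁺; cartesianProduct⁺; Unique[x∷xs]⇒x∉xs)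
open import Data.Nat.Base using (ℕ; zero; suc; _≤_; s≤s; _+_; _*_; _^_; _∸_)
open import Data.Nat.Tactic.RingSolver using (solve-∀)
open import Data.Product.Base using (_×_; _,_; proj₁; proj₂)
open import Data.Sum.Base using (inj₁; inj₂; [_,_]′)
open import Function.Base using (_∘_)
open import Function.Bundles using (mk⇔; module Equivalence)
open import Level using (0ℓ)
open import Relation.Binary.PropositionalEquality.Core
  using (_≡_; _≢_; refl; sym; trans; cong; cong₂; subst)
open import Relation.Binary.PropositionalEquality.Properties using (setoid)
open import Relation.Nullary.Negation.Core using (¬_; contradiction)
open import Relation.Unary using (Pred; U; ∁; ｛_｝; _∪_; _∩_; _⊆_; _⟨×⟩_)

open Equivalence using (to; from)

-- Cardinalities of unions, products, complements and images.

private
  variable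
    A B : Set
    P Q R : Pred A 0ℓ
    m n o : ℕ

card-cast : m ≡ n → HasCard P m → HasCard P n
card-cast refl c = c

card-resp : P ⊆ Q → Q ⊆ P → HasCard P m → HasCard Q m
card-resp P⊆Q Q⊆P (xs , xs! , ∈xs , ∣xs∣) =
  xs , xs! , (λ x → mk⇔ (P⊆Q ∘ to (∈xs x)) (from (∈xs x) ∘ Q⊆P)) , ∣xs∣

card-｛｝ : (a : A) → HasCard ｛ a ｝ 1
card-｛｝ a = a ∷ [] , [] ∷ [] ,
  (λ x → mk⇔ (λ { (here refl) → refl }) (λ { refl → here refl })) , refl

card-Fin : ∀ n → HasCard {Fin n} U n
card-Fin n = allFin n , allFin⁺ n , (λ x → mk⇔ _ (λ _ → ∈-allFin x)) , length-tabulate _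

card-∪ : (∀ {x} → P x → Q x → ⊥) → HasCard P m → HasCard Q n → HasCard (P ∪ Q) (m + n)
card-∪ P⊥Q (xs , xs! , ∈xs , ∣xs∣) (ys , ys! , ∈ys , ∣ys∣) =
  xs ++ ys ,
  ++⁺ xs! ys! (λ {v} (p , q) → P⊥Q (to (∈xs v) p) (to (∈ys v) q)) ,
  (λ x → mk⇔ ([ inj₁ ∘ to (∈xs x) , inj₂ ∘ to (∈ys x) ]′ ∘ ∈-++⁻ xs)
             [ ∈-++⁺ˡ ∘ from (∈xs x) , ∈-++⁺ʳ xs ∘ from (∈ys x) ]′) ,
  trans (length-++ xs) (cong₂ _+_ ∣xs∣ ∣ys∣)

card-∪₃ : (∀ {x} → P x → Q x → ⊥) → (∀ {x} → P x → R x → ⊥) → (∀ {x} → Q x → R x → ⊥) →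
          HasCard P m → HasCard Q n → HasCard R o → HasCard (P ∪ Q ∪ R) (m + (n + o))
card-∪₃ P⊥Q P⊥R Q⊥R p q r = card-∪ (λ x → [ P⊥Q x , P⊥R x ]′) p (card-∪ Q⊥R q r)

length-cartesianProduct : (xs : List A) (ys : List B) →
  length (cartesianProduct xs ys) ≡ length xs * length ys
length-cartesianProduct []       ys = refl
length-cartesianProduct (x ∷ xs) ys = trans (length-++ (map (x ,_) ys))
  (cong₂ _+_ (length-map (x ,_) ys) (length-cartesianProduct xs ys))

card-⟨×⟩ : HasCard P m → HasCard Q n → HasCard (P ⟨×⟩ Q) (m * n)
card-⟨×⟩ (xs , xs! , ∈xs , ∣xs∣) (ys , ys! , ∈ys , ∣ys∣) =
  cartesianProduct xs ys ,
  cartesianProduct⁺ xs! ys! ,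
  (λ (x , y) → mk⇔
    (λ xy∈ → let x∈ , y∈ = ∈-cartesianProduct⁻ xs ys xy∈ in to (∈xs x) x∈ , to (∈ys y) y∈)
    (λ (p , q) → ∈-cartesianProduct⁺ (from (∈xs x) p) (from (∈ys y) q))) ,
  trans (length-cartesianProduct xs ys) (cong₂ _*_ ∣xs∣ ∣ys∣)

-- `shift` moves the occurrence of `a` to the front of the listing. Uniqueness survives this
-- permutation, so what remains behind `a` lists exactly the other elements.
card-∖ : ∀ {a} → P a → HasCard P m → HasCard (P ∩ ∁ ｛ a ｝) (m ∸ 1)
card-∖ {a = a} pa (xs , xs! , ∈xs , refl) with ∈-∃++ (from (∈xs a) pa)
... | ys , zs , refl with Permutationₛ.Unique-resp-↭ (setoid _) (↭⇒↭ₛ (shift a ys zs)) xs!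
... | a∷! @ (_ ∷ !) = ys ++ zs , ! ,
  (λ x → mk⇔
    (λ x∈ → to (∈xs x) (∈-resp-↭ (↭-sym (shift a ys zs)) (there x∈)) ,
            λ { refl → Unique[x∷xs]⇒x∉xs a∷! x∈ })
    (λ (px , a≢x) → drop-here (a≢x ∘ sym) (∈-resp-↭ (shift a ys zs) (from (∈xs x) px)))) ,
  sym (cong (_∸ 1) (↭-length (shift a ys zs)))
  where
  drop-here : ∀ {x a} {ws : List _} → x ≢ a → x ∈ a ∷ ws → x ∈ ws
  drop-here x≢a (here x≡a) = contradiction x≡a x≢a
  drop-here x≢a (there x∈) = x∈

card-∁｛｝ : (a : Fin n) → HasCard (∁ ｛ a ｝) (n ∸ 1)
card-∁｛｝ {n} a = card-resp proj₂ (_ ,_) (card-∖ _ (card-Fin n))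

-- The left inverse `g` makes `f` injective, so the mapped listing has no repetition. The other
-- inverse law is asked on `Q` only, which lets `Q` be a proper subset of `B`, such as the graph of
-- a division map.
card-image : {f : A → B} {g : B → A} → (∀ x → g (f x) ≡ x) →
             (∀ {x} → P x → Q (f x)) → (∀ {y} → Q y → P (g y) × f (g y) ≡ y) →
             HasCard P m → HasCard Q m
card-image {Q = Q} {f = f} {g = g} gf P⇒Q Q⇒P (xs , xs! , ∈xs , ∣xs∣) =
  map f xs ,
  map⁺ (λ {x} {y} fx≡fy → trans (sym (gf x)) (trans (cong g fx≡fy) (gf y))) xs! ,
  (λ y → mk⇔
    (λ y∈ → let x , x∈ , y≡fx = ∈-map⁻ f y∈ in subst Q (sym y≡fx) (P⇒Q (to (∈xs x) x∈)))
    (λ qy → let pgy , fgy≡y = Q⇒P qy in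
            subst (_∈ map f xs) fgy≡y (∈-map⁺ f (from (∈xs (g y)) pgy)))) ,
  trans (length-map f xs) ∣xs∣

module _ {n : ℕ} {_∙_ _\\_ _//_ : Op₂ (Fin (2 + n))}
         (isQuasigroup : IsQuasigroup _≡_ _∙_ _\\_ _//_) where

  open IsQuasigroup isQuasigroup using (leftDividesˡ; leftDividesʳ; rightDividesˡ; rightDividesʳ)
  open Digraph (Γ₁ _∙_)

  private
    -- In this form `N ∸ 1` and `N ∸ 1 ∸ 1` reduce to `1 + n` and `n`, free of truncated
    -- subtraction.
    N = 2 + n

    box : {P Q : Pred (Fin N) 0ℓ} → ∀ {j k} (i : Fin 2) → HasCard P j → HasCard Q k →
          HasCard (P ⟨×⟩ Q ⟨×⟩ ｛ i ｝) (j * (k * 1))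
    box i p q = card-⟨×⟩ p (card-⟨×⟩ q (card-｛｝ i))

  -- The automorphism that exchanges the layers.

  σ : Vertex → Vertex
  σ (x , y , i) = y , x , opposite i

  σ-involutive : ∀ u → σ (σ u) ≡ u
  σ-involutive (x , y , 0F) = refl
  σ-involutive (x , y , 1F) = refl

  -- The two kinds of moves inside a layer are exchanged. The two crossing rules are exchanged
  -- because the rule leaving layer 1 multiplies in the reverse order.
  σ-arc : ∀ {u v} → Arc u v → Arc (σ u) (σ v)
  σ-arc (fst-coord i x y z x≢z) = snd-coord (opposite i) y x z x≢z
  σ-arc (snd-coord i x y z y≢z) = fst-coord (opposite i) y x z y≢z
  σ-arc (zero-one x y z)        = one-zero y x z
  σ-arc (one-zero x y z)        = zero-one y x z

  -- As `σ` is an involution, applying it to both ends of an arc shifts a `σ` from one end to the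
  -- other.
  σ-arcˡ : ∀ u {v} → Arc (σ u) v → Arc u (σ v)
  σ-arcˡ u = subst (λ w → Arc w _) (σ-involutive u) ∘ σ-arc

  σ-arcʳ : ∀ {u} v → Arc u (σ v) → Arc (σ u) v
  σ-arcʳ v = subst (Arc _) (σ-involutive v) ∘ σ-arc

  card-σ : (∀ {u} → P u → Q (σ u)) → (∀ {u} → Q u → P (σ u)) → HasCard P m → HasCard Q m
  card-σ P⇒Q Q⇒P = card-image σ-involutive P⇒Q (λ {u} qu → Q⇒P qu , σ-involutive u)

  -- Loops, out-degrees and in-degrees.

  arc-irrefl : ∀ u → ¬ Arc u u
  arc-irrefl u (fst-coord i x y x x≢x) = x≢x refl
  arc-irrefl u (snd-coord i x y y y≢y) = y≢y refl

  out-card : ∀ u → HasCard (Arc u) (3 * N ∸ 2)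
  out-card (x , y , 0F) = card-cast (count n) (card-resp
    (λ { (inj₁ (x≢z , refl , refl))        → fst-coord 0F x y _ x≢z
       ; (inj₂ (inj₁ (refl , y≢z , refl))) → snd-coord 0F x y _ y≢z
       ; (inj₂ (inj₂ (refl , _ , refl)))   → zero-one x y _ })
    (λ { (fst-coord _ _ _ _ x≢z) → inj₁ (x≢z , refl , refl)
       ; (snd-coord _ _ _ _ y≢z) → inj₂ (inj₁ (refl , y≢z , refl))
       ; (zero-one _ _ _)        → inj₂ (inj₂ (refl , _ , refl)) })
    -- The first two boxes disagree on whether the first coordinate is `x`; the third lies in the
    -- other layer.
    (card-∪₃ (λ { (x≢x , _) (refl , _) → x≢x refl })
             (λ { (_ , _ , refl) (_ , _ , ()) })
             (λ { (_ , _ , refl) (_ , _ , ()) })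
      (box 0F (card-∁｛｝ x) (card-｛｝ y))
      (box 0F (card-｛｝ x) (card-∁｛｝ y))
      (box 1F (card-｛｝ (x ∙ y)) (card-Fin N))))
    where
    count : ∀ n → (1 + n) * (1 * 1) + (1 * ((1 + n) * 1) + 1 * ((2 + n) * 1)) ≡ 3 * (2 + n) ∸ 2
    -- Adding 2 to both sides gives an identity of semiring expressions for the ring solver; the
    -- subtraction then cancels by computation.
    count n = cong (_∸ 2) (identity n)
      where
      identity : ∀ n → 2 + ((1 + n) * (1 * 1) + (1 * ((1 + n) * 1) + 1 * ((2 + n) * 1))) ≡ 3 * (2 + n)
      identity = solve-∀
  out-card (x , y , 1F) = card-σ σ-arc (σ-arcˡ (y , x , 0F)) (out-card (y , x , 0F))

  in-card : ∀ v → HasCard (λ u → Arc u v) (3 * N ∸ 2)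
  in-card (a , b , 0F) = card-cast (count n) (card-resp
    (λ { (inj₁ (a≢x , refl , refl))        → fst-coord 0F _ b a (a≢x ∘ sym)
       ; (inj₂ (inj₁ (refl , b≢y , refl))) → snd-coord 0F a _ b (b≢y ∘ sym)
       ; (inj₂ (inj₂ (refl , refl)))       → one-zero _ _ a })
    (λ { (fst-coord _ _ _ _ x≢a) → inj₁ (x≢a ∘ sym , refl , refl)
       ; (snd-coord _ _ _ _ y≢b) → inj₂ (inj₁ (refl , y≢b ∘ sym , refl))
       ; (one-zero _ _ _)        → inj₂ (inj₂ (refl , refl)) })
    (card-∪₃ (λ { (a≢a , _) (refl , _) → a≢a refl })
             (λ { (_ , _ , refl) (_ , ()) })
             (λ { (_ , _ , refl) (_ , ()) })
      (box 0F (card-∁｛｝ a) (card-｛｝ b))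
      (box 0F (card-｛｝ a) (card-∁｛｝ b))
      -- An in-neighbour `(x , y , 1F)` satisfies `y ∙ x ≡ b`, so `x` is free and `y` must be
      -- `b // x`: there are `N` of them.
      (card-image {Q = λ (x , y , i) → y ∙ x ≡ b × 1F ≡ i} {f = λ x → x , b // x , 1F} {g = proj₁}
        (λ _ → refl)
        (λ {x} _ → rightDividesˡ x b , refl)
        (λ { {x , y , _} (refl , refl) → _ , cong (λ y′ → x , y′ , 1F) (rightDividesʳ x y) })
        (card-Fin N))))
    where
    count : ∀ n → (1 + n) * (1 * 1) + (1 * ((1 + n) * 1) + (2 + n)) ≡ 3 * (2 + n) ∸ 2
    count n = cong (_∸ 2) (identity n)
      where
      identity : ∀ n → 2 + ((1 + n) * (1 * 1) + (1 * ((1 + n) * 1) + (2 + n))) ≡ 3 * (2 + n)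
      identity = solve-∀
  in-card (a , b , 1F) = card-σ σ-arc (σ-arcʳ (b , a , 0F)) (in-card (b , a , 0F))

  -- Arcs between the layers in terms of division; undirected edges.

  -- The rule demands `y ∙ x ≡ b`. With the converse `arc-one-zero-//`, a vertex of layer 0 has
  -- exactly one in-neighbour in layer 1 with given first coordinate; this is the single detour
  -- through layer 1 in the path counts.
  arc-one-zero⇒// : ∀ {x y a b} → Arc (x , y , 1F) (a , b , 0F) → b // x ≡ y
  arc-one-zero⇒// (one-zero x y _) = rightDividesʳ x y

  arc-one-zero-// : ∀ x a b → Arc (x , b // x , 1F) (a , b , 0F)
  arc-one-zero-// x a b = subst (λ b′ → Arc _ (a , b′ , 0F)) (rightDividesˡ x b) (one-zero x (b // x) a)

  -- Moves inside a layer can all be reversed. Of the `N` arcs to the other layer exactly one can: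
  -- `(x ∙ y , z , 1F)` points back only if `z ∙ (x ∙ y) ≡ y`.
  undirected-card : ∀ u → HasCard (λ v → Arc u v × Arc v u) (2 * N ∸ 1)
  undirected-card (x , y , 0F) = card-cast (count n) (card-resp
    (λ { (inj₁ (x≢z , refl , refl))        → fst-coord 0F x y _ x≢z , fst-coord 0F _ y x (x≢z ∘ sym)
       ; (inj₂ (inj₁ (refl , y≢z , refl))) → snd-coord 0F x y _ y≢z , snd-coord 0F x _ y (y≢z ∘ sym)
       ; (inj₂ (inj₂ refl))                → zero-one x y _ , arc-one-zero-// (x ∙ y) x y })
    (λ { (fst-coord _ _ _ _ x≢z , _) → inj₁ (x≢z , refl , refl)
       ; (snd-coord _ _ _ _ y≢z , _) → inj₂ (inj₁ (refl , y≢z , refl))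
       ; (zero-one _ _ _ , vu)       → inj₂ (inj₂ (cong (λ z → x ∙ y , z , 1F) (arc-one-zero⇒// vu))) })
    (card-∪₃ (λ { (x≢x , _) (refl , _) → x≢x refl })
             (λ { (_ , _ , refl) () })
             (λ { (_ , _ , refl) () })
      (box 0F (card-∁｛｝ x) (card-｛｝ y))
      (box 0F (card-｛｝ x) (card-∁｛｝ y))
      (card-｛｝ (x ∙ y , y // (x ∙ y) , 1F))))
    where
    count : ∀ n → (1 + n) * (1 * 1) + (1 * ((1 + n) * 1) + 1) ≡ 2 * (2 + n) ∸ 1
    count n = cong (_∸ 1) (identity n)
      where
      identity : ∀ n → 1 + ((1 + n) * (1 * 1) + (1 * ((1 + n) * 1) + 1)) ≡ 2 * (2 + n)
      identity = solve-∀
  undirected-card (x , y , 1F) =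
    card-σ (λ (uv , vu) → σ-arc uv , σ-arc vu)
           (λ (uv , vu) → σ-arcˡ (y , x , 0F) uv , σ-arcʳ (y , x , 0F) vu)
           (undirected-card (y , x , 0F))

  arc-zero-one⇒\\ : ∀ {x y a b} → Arc (x , y , 0F) (a , b , 1F) → x \\ a ≡ y
  arc-zero-one⇒\\ (zero-one x y _) = leftDividesʳ x y

  -- Given `a`, each coordinate of the source determines the other. Hence a path that changes one
  -- chosen coordinate and then crosses to a given vertex has at most one middle vertex.
  arc-zero-one⇒// : ∀ {x y a b} → Arc (x , y , 0F) (a , b , 1F) → a // y ≡ x
  arc-zero-one⇒// (zero-one x y _) = rightDividesʳ y x

  arc-zero-one : ∀ {x y a} b → x ∙ y ≡ a → Arc (x , y , 0F) (a , b , 1F)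
  arc-zero-one b refl = zero-one _ _ b

  -- Counting paths of length 2.

  Path : Vertex → Vertex → Pred Vertex 0ℓ
  Path u v w = Arc u w × Arc w v

  path-σ : ∀ u v → HasCard (Path (σ u) (σ v)) m → HasCard (Path u v) m
  path-σ u v = card-σ (λ (uw , wv) → σ-arcˡ u uw , σ-arcʳ v wv) (λ (uw , wv) → σ-arc uw , σ-arc wv)

  -- Two vertices on a line of layer 0 are joined through the `N ∸ 2` others on that line and by one
  -- detour through layer 1. For an arc into layer 1, the middle vertices are the `N ∸ 1` other
  -- vertices of layer 1 with first coordinate `x ∙ y`.
  arc-path-card₀ : ∀ x y v → Arc (x , y , 0F) v → HasCard (Path (x , y , 0F) v) (N ∸ 1)
  arc-path-card₀ x y (a , y , 0F) (fst-coord _ _ _ _ x≢a) = card-cast (count n) (card-resp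
    (λ { (inj₁ ((x≢z , a≢z) , refl , refl)) → fst-coord 0F x y _ x≢z , fst-coord 0F _ y a (a≢z ∘ sym)
       ; (inj₂ refl)                        → zero-one x y _ , arc-one-zero-// (x ∙ y) a y })
    (λ { (fst-coord _ _ _ _ x≢z , fst-coord _ _ _ _ z≢a) → inj₁ ((x≢z , z≢a ∘ sym) , refl , refl)
       ; (fst-coord _ _ _ _ _   , snd-coord _ _ _ _ y≢y) → contradiction refl y≢y
       ; (snd-coord _ _ _ _ y≢z , fst-coord _ _ _ _ _)   → contradiction refl y≢z
       ; (snd-coord _ _ _ _ _   , snd-coord _ _ _ _ _)   → contradiction refl x≢a
       ; (zero-one _ _ _        , wv)                    →
           inj₂ (cong (λ z → x ∙ y , z , 1F) (arc-one-zero⇒// wv)) })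
    (card-∪ (λ { (_ , _ , refl) () })
      (box 0F (card-∖ x≢a (card-∁｛｝ x)) (card-｛｝ y))
      (card-｛｝ (x ∙ y , y // (x ∙ y) , 1F))))
    where
    count : ∀ n → n * (1 * 1) + 1 ≡ 1 + n
    count = solve-∀
  arc-path-card₀ x y (x , b , 0F) (snd-coord _ _ _ _ y≢b) = card-cast (count n) (card-resp
    (λ { (inj₁ (refl , (y≢z , b≢z) , refl)) → snd-coord 0F x y _ y≢z , snd-coord 0F x _ b (b≢z ∘ sym)
       ; (inj₂ refl)                        → zero-one x y _ , arc-one-zero-// (x ∙ y) x b })
    (λ { (snd-coord _ _ _ _ y≢z , snd-coord _ _ _ _ z≢b) → inj₁ (refl , (y≢z , z≢b ∘ sym) , refl)
       ; (snd-coord _ _ _ _ _   , fst-coord _ _ _ _ x≢x) → contradiction refl x≢x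
       ; (fst-coord _ _ _ _ x≢z , snd-coord _ _ _ _ _)   → contradiction refl x≢z
       ; (fst-coord _ _ _ _ _   , fst-coord _ _ _ _ _)   → contradiction refl y≢b
       ; (zero-one _ _ _        , wv)                    →
           inj₂ (cong (λ z → x ∙ y , z , 1F) (arc-one-zero⇒// wv)) })
    (card-∪ (λ { (_ , _ , refl) () })
      (box 0F (card-｛｝ x) (card-∖ y≢b (card-∁｛｝ y)))
      (card-｛｝ (x ∙ y , b // (x ∙ y) , 1F))))
    where
    count : ∀ n → 1 * (n * 1) + 1 ≡ 1 + n
    count = solve-∀
  arc-path-card₀ x y (_ , b , 1F) (zero-one _ _ _) = card-cast (count n) (card-resp
    (λ { (refl , b≢z , refl) → zero-one x y _ , snd-coord 1F (x ∙ y) _ b (b≢z ∘ sym) })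
    (λ { (zero-one _ _ _ , wv) → refl , same-row wv ∘ sym , refl
       -- A middle vertex in layer 0 would differ from `(x , y)` in one coordinate and still have
       -- product `x ∙ y`, against cancellation.
       ; (fst-coord _ _ _ _ x≢z , wv) → contradiction (trans (sym (rightDividesʳ y x)) (arc-zero-one⇒// wv)) x≢z
       ; (snd-coord _ _ _ _ y≢z , wv) → contradiction (trans (sym (leftDividesʳ x y)) (arc-zero-one⇒\\ wv)) y≢z })
    (box 1F (card-｛｝ (x ∙ y)) (card-∁｛｝ b)))
    where
    same-row : ∀ {a y b} → Arc (a , y , 1F) (a , b , 1F) → y ≢ b
    same-row (fst-coord _ _ _ _ a≢a) = contradiction refl a≢a
    same-row (snd-coord _ _ _ _ y≢b) = y≢b
    count : ∀ n → 1 * ((1 + n) * 1) ≡ 1 + n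
    count = solve-∀

  -- Inside layer 0 the hypotheses force both coordinates to differ, so the paths are the two around
  -- the corners and one detour. For a target in layer 1 they force `x ∙ y ≢ a`; a path corrects the
  -- product by changing `y` or by changing `x`, or crosses first and then changes the first
  -- coordinate to `a`.
  ¬arc-path-card₀ : ∀ x y v → (x , y , 0F) ≢ v → ¬ Arc (x , y , 0F) v → HasCard (Path (x , y , 0F) v) 3
  ¬arc-path-card₀ x y (a , b , 0F) u≢v ¬uv = card-resp
    (λ { (inj₁ refl)        → snd-coord 0F x y b y≢b , fst-coord 0F x b a x≢a
       ; (inj₂ (inj₁ refl)) → fst-coord 0F x y a x≢a , snd-coord 0F a y b y≢b
       ; (inj₂ (inj₂ refl)) → zero-one x y _ , arc-one-zero-// (x ∙ y) a b })
    (λ { (snd-coord _ _ _ _ _ , fst-coord _ _ _ _ _) → inj₁ refl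
       ; (snd-coord _ _ _ _ _ , snd-coord _ _ _ _ _) → contradiction refl x≢a
       ; (fst-coord _ _ _ _ _ , snd-coord _ _ _ _ _) → inj₂ (inj₁ refl)
       ; (fst-coord _ _ _ _ _ , fst-coord _ _ _ _ _) → contradiction refl y≢b
       ; (zero-one _ _ _      , wv)                  →
           inj₂ (inj₂ (cong (λ z → x ∙ y , z , 1F) (arc-one-zero⇒// wv))) })
    (card-∪₃ (λ { refl refl → x≢a refl }) (λ { refl () }) (λ { refl () })
      (card-｛｝ (x , b , 0F))
      (card-｛｝ (a , y , 0F))
      (card-｛｝ (x ∙ y , b // (x ∙ y) , 1F)))
    where
    x≢a : x ≢ a
    x≢a refl = ¬uv (snd-coord 0F x y b (λ { refl → u≢v refl }))
    y≢b : y ≢ b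
    y≢b refl = ¬uv (fst-coord 0F x y a (λ { refl → u≢v refl }))
  ¬arc-path-card₀ x y (a , b , 1F) u≢v ¬uv = card-resp
    (λ { (inj₁ refl)        → snd-coord 0F x y _ (λ { y≡x\\a → xy≢a (trans (cong (x ∙_) y≡x\\a) (leftDividesˡ x a)) }) ,
                              arc-zero-one b (leftDividesˡ x a)
       ; (inj₂ (inj₁ refl)) → fst-coord 0F x y _ (λ { x≡a//y → xy≢a (x≡a//y⇒xy≡a x≡a//y) }) ,
                              arc-zero-one b (rightDividesˡ y a)
       ; (inj₂ (inj₂ refl)) → zero-one x y b , fst-coord 1F (x ∙ y) b a xy≢a })
    (λ { (snd-coord _ _ _ _ _ , wv) → inj₁ (cong (λ z → x , z , 0F) (arc-zero-one⇒\\ wv))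
       ; (fst-coord _ _ _ _ _ , wv) → inj₂ (inj₁ (cong (λ z → z , y , 0F) (arc-zero-one⇒// wv)))
       ; (zero-one _ _ _      , wv) → inj₂ (inj₂ (cong (λ z → x ∙ y , z , 1F) (same-column xy≢a wv))) })
    -- The first two middle vertices could coincide only if `x ≡ a // y`, that is `x ∙ y ≡ a`.
    (card-∪₃ (λ { refl eq → xy≢a (x≡a//y⇒xy≡a (cong proj₁ (sym eq))) }) (λ { refl () }) (λ { refl () })
      (card-｛｝ (x , x \\ a , 0F))
      (card-｛｝ (a // y , y , 0F))
      (card-｛｝ (x ∙ y , b , 1F)))
    where
    xy≢a : x ∙ y ≢ a
    xy≢a refl = ¬uv (zero-one x y b)
    x≡a//y⇒xy≡a : x ≡ a // y → x ∙ y ≡ a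
    x≡a//y⇒xy≡a x≡a//y = trans (cong (_∙ y) x≡a//y) (rightDividesˡ y a)
    same-column : ∀ {x a y b} → x ≢ a → Arc (x , y , 1F) (a , b , 1F) → b ≡ y
    same-column _   (fst-coord _ _ _ _ _) = refl
    same-column x≢x (snd-coord _ _ _ _ _) = contradiction refl x≢x

  arc-path-card : ∀ u v → Arc u v → HasCard (Path u v) (N ∸ 1)
  arc-path-card (x , y , 0F) v uv = arc-path-card₀ x y v uv
  arc-path-card u@(x , y , 1F) v uv = path-σ u v (arc-path-card₀ y x (σ v) (σ-arc uv))

  ¬arc-path-card : ∀ u v → u ≢ v → ¬ Arc u v → HasCard (Path u v) 3
  ¬arc-path-card (x , y , 0F) v u≢v ¬uv = ¬arc-path-card₀ x y v u≢v ¬uv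
  ¬arc-path-card u@(x , y , 1F) v u≢v ¬uv = path-σ u v (¬arc-path-card₀ y x (σ v)
    (λ σu≡σv → u≢v (trans (cong σ σu≡σv) (σ-involutive v)))
    (λ σuσv → ¬uv (subst (Arc u) (σ-involutive v) (σ-arc σuσv))))

  -- The number of vertices, and the parameters put together.

  vertex-card : HasCard {Vertex} U (2 * N ^ 2)
  vertex-card = card-cast (count N) (card-resp _ _
    (card-⟨×⟩ (card-Fin N) (card-⟨×⟩ (card-Fin N) (card-Fin 2))))
    where
    -- `k * (k * 1)` is what `k ^ 2` unfolds to.
    count : ∀ k → k * (k * 2) ≡ 2 * (k * (k * 1))
    count = solve-∀

theorem4p1 : (n : ℕ) → 2 ≤ n →
    (_∙_ _\\_ _//_ : Op₂ (Fin n)) → IsQuasigroup _≡_ _∙_ _\\_ _//_ →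
    IsDSRG (Γ₁ _∙_) (2 * n ^ 2) (3 * n ∸ 2) (2 * n ∸ 1) (n ∸ 1) 3
theorem4p1 (suc (suc n)) _ _∙_ _\\_ _//_ isQuasigroup = record
  { order      = vertex-card isQuasigroup
  ; loopless   = arc-irrefl isQuasigroup
  ; out-degree = out-card isQuasigroup
  ; in-degree  = in-card isQuasigroup
  ; undirected = undirected-card isQuasigroup
  ; paths-arc  = λ u v _ → arc-path-card isQuasigroup u v
  ; paths-¬arc = ¬arc-path-card isQuasigroup
  }
theorem4p1 (suc zero) (s≤s ())
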